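{- Let $n\ge1$ and let $P=\{(i,j)\colon 1\le i\le j\le n\}$ be the shifted staircase. Fix $0\le k\le n-1$ and let $B=\{(i,j)\in P\colon j-i=k\}$. Then $\sum_{p\in B}\mathbb{1}_p\equiv (n-k)/2$.
   Context: $P$ is ordered by $(i,j)\le(i',j')$ iff $i\le i'$ and $j\le j'$. $\mathcal{J}(P)$ is the set of order ideals of $P$. For $x\in P$, $I\in\mathcal{J}(P)$: $\mathbb{1}_x(I)=1$ if $x\in I$, else $0$; $T_x^+(I)=1$ if $x$ is a minimal element of $P\setminus I$, else $0$; $T_x^-(I)=1$ if $x$ is a maximal element of $I$, else $0$; $T_x=T_x^+-T_x^-$. For $f,g\colon\mathcal{J}(P)\to\mathbb{R}$, $f\equiv g$ means $f-g=\sum_{x\in P}c_xT_x$ for some real constants $c_x$; a real number denotes the corresponding constant function. -}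

module Defs where

open import Data.Bool using (Bool; true; if_then_else_)
import Data.Bool.Properties as Bool
open import Data.Fin using (Fin; toℕ)
import Data.Fin as Fin
import Data.Fin.Properties as Fin
open import Data.List using (List; _∷_; foldr; map; mapMaybe; filter; allFin; cartesianProduct)
open import Data.List.Membership.Propositional renaming (_∈_ to _∈ˡ_) using ()
open import Data.List.Membership.Propositional.Properties using (∈-cartesianProduct⁺; ∈-allFin)
open import Data.List.Relation.Unary.All as All using (All)
open import Data.List.Relation.Unary.Any using (here; there)
open import Data.Maybe using (Maybe; just; nothing)
open import Data.Nat using (ℕ; _∸_) renaming (_≤_ to _≤ℕ_; _⊔_ to _⊔ℕ_)
import Data.Nat.Properties as ℕ
open import Data.Product using (_×_; _,_; ∃-syntax; Σ-syntax)
open import Data.Rational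
open import Data.Rational.Properties
open import Data.Rational.Solver using (module +-*-Solver)
open import Level using (0ℓ)
open import Relation.Binary using (DecidableEquality; Decidable)
open import Relation.Binary.PropositionalEquality
open import Relation.Nullary using (¬_; Dec; yes; no; does; ¬?; _×-dec_; _→-dec_; map′)
open import Relation.Nullary.Negation using (contradiction-irr)
open import Relation.Unary using (Pred) renaming (Decidable to Decidable₁)

-- A real number is represented by a Cauchy sequence of rationals; two
-- representatives are identified by _≈_ rather than by _≡_.
IsCauchy : (ℕ → ℚ) → Set
IsCauchy x = ∀ ε → 0ℚ < ε → ∃[ N ] (∀ m n → N ≤ℕ m → N ≤ℕ n → ∣ x m - x n ∣ < ε)

record ℝ : Set where
  constructor mkℝ
  field
    seq    : ℕ → ℚ
    cauchy : IsCauchy seq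

open ℝ public

infix 4 _≈_

_≈_ : ℝ → ℝ → Set
x ≈ y = ∀ ε → 0ℚ < ε → ∃[ N ] (∀ n → N ≤ℕ n → ∣ seq x n - seq y n ∣ < ε)

fromℚ : ℚ → ℝ
fromℚ q = mkℝ (λ _ → q) λ ε 0<ε → 0 , λ _ _ _ _ →
  subst (_< ε) (sym (cong ∣_∣ (+-inverseʳ q))) 0<ε

0ℝ 1ℝ : ℝ
0ℝ = fromℚ 0ℚ
1ℝ = fromℚ 1ℚ

private
  open +-*-Solver using (solve; _:=_; _:+_; _:*_; _:-_; :-_)
  open ≤-Reasoning

  half : ∀ ε → ½ * ε + ½ * ε ≡ ε
  half ε = trans (sym (*-distribʳ-+ ε ½ ½)) (*-identityˡ ε)

  0<half : ∀ {ε} → 0ℚ < ε → 0ℚ < ½ * ε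
  0<half {ε} 0<ε = positive⁻¹ (½ * ε) {{pos*pos⇒pos ½ ε {{positive 0<ε}}}}

  +-cauchy : ∀ {x y} → IsCauchy x → IsCauchy y → IsCauchy (λ n → x n + y n)
  +-cauchy {x} {y} cx cy ε 0<ε
    with cx (½ * ε) (0<half 0<ε) | cy (½ * ε) (0<half 0<ε)
  ... | M , p | N , q = M ⊔ℕ N , λ m n l l′ → begin-strict
    ∣ (x m + y m) - (x n + y n) ∣      ≡⟨ cong ∣_∣ (rearrange (x m) (y m) (x n) (y n)) ⟩
    ∣ (x m - x n) + (y m - y n) ∣      ≤⟨ ∣p+q∣≤∣p∣+∣q∣ (x m - x n) (y m - y n) ⟩
    ∣ x m - x n ∣ + ∣ y m - y n ∣      <⟨ +-mono-< (p m n (ℕ.m⊔n≤o⇒m≤o M N l) (ℕ.m⊔n≤o⇒m≤o M N l′))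
                                                   (q m n (ℕ.m⊔n≤o⇒n≤o M N l) (ℕ.m⊔n≤o⇒n≤o M N l′)) ⟩
    ½ * ε + ½ * ε                      ≡⟨ half ε ⟩
    ε                                  ∎
    where
    rearrange : ∀ a b c d → (a + b) - (c + d) ≡ (a - c) + (b - d)
    rearrange = solve 4 (λ a b c d → (a :+ b) :- (c :+ d) := (a :- c) :+ (b :- d)) refl

  neg-cauchy : ∀ {x} → IsCauchy x → IsCauchy (λ n → - x n)
  neg-cauchy {x} cx ε 0<ε with cx ε 0<ε
  ... | N , p = N , λ m n l l′ → begin-strict
    ∣ - x m - - x n ∣    ≡⟨ cong ∣_∣ (rearrange (x m) (x n)) ⟩
    ∣ - (x m - x n) ∣    ≡⟨ ∣-p∣≡∣p∣ (x m - x n) ⟩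
    ∣ x m - x n ∣        <⟨ p m n l l′ ⟩
    ε                    ∎
    where
    rearrange : ∀ a b → - a - - b ≡ - (a - b)
    rearrange = solve 2 (λ a b → (:- a) :- (:- b) := :- (a :- b)) refl

  eventuallyBounded : ∀ {x} → IsCauchy x →
    ∃[ K ] (0ℚ < K × ∃[ N ] (∀ m → N ≤ℕ m → ∣ x m ∣ < K))
  eventuallyBounded {x} cx with cx 1ℚ (positive⁻¹ 1ℚ)
  ... | N , p = 1ℚ + ∣ x N ∣
              , +-mono-<-≤ (positive⁻¹ 1ℚ) (0≤∣p∣ (x N))
              , N , λ m l → begin-strict
    ∣ x m ∣                    ≡⟨ cong ∣_∣ (rearrange (x m) (x N)) ⟩
    ∣ (x m - x N) + x N ∣      ≤⟨ ∣p+q∣≤∣p∣+∣q∣ (x m - x N) (x N) ⟩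
    ∣ x m - x N ∣ + ∣ x N ∣    <⟨ +-monoˡ-< ∣ x N ∣ (p m N l ℕ.≤-refl) ⟩
    1ℚ + ∣ x N ∣               ∎
    where
    rearrange : ∀ a b → a ≡ (a - b) + b
    rearrange = solve 2 (λ a b → a := (a :- b) :+ b) refl

  abs-*-< : ∀ a b {K δ} → 0ℚ < K → ∣ a ∣ < K → ∣ b ∣ < δ → ∣ a * b ∣ < K * δ
  abs-*-< a b {K} {δ} 0<K a<K b<δ = begin-strict
    ∣ a * b ∣        ≡⟨ ∣p*q∣≡∣p∣*∣q∣ a b ⟩
    ∣ a ∣ * ∣ b ∣    ≤⟨ *-monoʳ-≤-nonNeg ∣ b ∣ {{∣-∣-nonNeg b}} (<⇒≤ a<K) ⟩
    K * ∣ b ∣        <⟨ *-monoʳ-<-pos K {{positive 0<K}} b<δ ⟩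
    K * δ            ∎

  divide : ∀ S ε → 0ℚ < S → 0ℚ < ε → ∃[ δ ] (0ℚ < δ × S * δ ≡ ε)
  divide S ε 0<S 0<ε =
      1/ S * ε
    , positive⁻¹ (1/ S * ε) {{pos*pos⇒pos (1/ S) {{1/pos⇒pos S}} ε {{positive 0<ε}}}}
    , trans (sym (*-assoc S (1/ S) ε))
            (trans (cong (_* ε) (*-inverseʳ S)) (*-identityˡ ε))
    where
    instance
      S-pos : Positive S
      S-pos = positive 0<S
      S-nonZero : NonZero S
      S-nonZero = pos⇒nonZero S

  *-rearrange : ∀ a b c d → a * b - c * d ≡ a * (b - d) + d * (a - c)
  *-rearrange = solve 4 (λ a b c d → a :* b :- c :* d := a :* (b :- d) :+ d :* (a :- c)) refl

  *-close : ∀ {a b c d K L δ ε} → 0ℚ < K → 0ℚ < L → ∣ a ∣ < K → ∣ d ∣ < L →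
            ∣ a - c ∣ < δ → ∣ b - d ∣ < δ → (K + L) * δ ≡ ε → ∣ a * b - c * d ∣ < ε
  *-close {a} {b} {c} {d} {K} {L} {δ} {ε} 0<K 0<L a<K d<L ac bd eq = begin-strict
    ∣ a * b - c * d ∣                        ≡⟨ cong ∣_∣ (*-rearrange a b c d) ⟩
    ∣ a * (b - d) + d * (a - c) ∣            ≤⟨ ∣p+q∣≤∣p∣+∣q∣ (a * (b - d)) (d * (a - c)) ⟩
    ∣ a * (b - d) ∣ + ∣ d * (a - c) ∣        <⟨ +-mono-< (abs-*-< a (b - d) 0<K a<K bd)
                                                         (abs-*-< d (a - c) 0<L d<L ac) ⟩
    K * δ + L * δ                            ≡⟨ sym (*-distribʳ-+ δ K L) ⟩
    (K + L) * δ                              ≡⟨ eq ⟩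
    ε                                        ∎

  *-cauchy : ∀ {x y} → IsCauchy x → IsCauchy y → IsCauchy (λ n → x n * y n)
  *-cauchy {x} {y} cx cy ε 0<ε = bounded (eventuallyBounded cx) (eventuallyBounded cy)
    where
    bounded : ∃[ K ] (0ℚ < K × ∃[ N ] (∀ m → N ≤ℕ m → ∣ x m ∣ < K)) →
              ∃[ L ] (0ℚ < L × ∃[ N ] (∀ m → N ≤ℕ m → ∣ y m ∣ < L)) →
              ∃[ N ] (∀ m n → N ≤ℕ m → N ≤ℕ n → ∣ x m * y m - x n * y n ∣ < ε)
    bounded (K , 0<K , M₁ , x<K) (L , 0<L , N₁ , y<L) =
      scaled (divide (K + L) ε (+-mono-< 0<K 0<L) 0<ε)
      where
      scaled : ∃[ δ ] (0ℚ < δ × (K + L) * δ ≡ ε) →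
               ∃[ N ] (∀ m n → N ≤ℕ m → N ≤ℕ n → ∣ x m * y m - x n * y n ∣ < ε)
      scaled (δ , 0<δ , [K+L]δ≡ε) = close (cx δ 0<δ) (cy δ 0<δ)
        where
        close : ∃[ N ] (∀ m n → N ≤ℕ m → N ≤ℕ n → ∣ x m - x n ∣ < δ) →
                ∃[ N ] (∀ m n → N ≤ℕ m → N ≤ℕ n → ∣ y m - y n ∣ < δ) →
                ∃[ N ] (∀ m n → N ≤ℕ m → N ≤ℕ n → ∣ x m * y m - x n * y n ∣ < ε)
        close (M₂ , p) (N₂ , q) = (M₁ ⊔ℕ N₁) ⊔ℕ (M₂ ⊔ℕ N₂) , λ m n l l′ →
          let l₁  = ℕ.m⊔n≤o⇒m≤o (M₁ ⊔ℕ N₁) (M₂ ⊔ℕ N₂) l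
              l₂  = ℕ.m⊔n≤o⇒n≤o (M₁ ⊔ℕ N₁) (M₂ ⊔ℕ N₂) l
              l₁′ = ℕ.m⊔n≤o⇒m≤o (M₁ ⊔ℕ N₁) (M₂ ⊔ℕ N₂) l′
              l₂′ = ℕ.m⊔n≤o⇒n≤o (M₁ ⊔ℕ N₁) (M₂ ⊔ℕ N₂) l′
          in *-close {x m} {y m} {x n} {y n} 0<K 0<L
               (x<K m (ℕ.m⊔n≤o⇒m≤o M₁ N₁ l₁))
               (y<L n (ℕ.m⊔n≤o⇒n≤o M₁ N₁ l₁′))
               (p m n (ℕ.m⊔n≤o⇒m≤o M₂ N₂ l₂) (ℕ.m⊔n≤o⇒m≤o M₂ N₂ l₂′))
               (q m n (ℕ.m⊔n≤o⇒n≤o M₂ N₂ l₂) (ℕ.m⊔n≤o⇒n≤o M₂ N₂ l₂′))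
               [K+L]δ≡ε

infixl 6 _+ᴿ_ _-ᴿ_
infixl 7 _*ᴿ_
infix  8 -ᴿ_

_+ᴿ_ _*ᴿ_ : ℝ → ℝ → ℝ
x +ᴿ y = mkℝ (λ n → seq x n + seq y n) (+-cauchy {seq x} {seq y} (cauchy x) (cauchy y))
x *ᴿ y = mkℝ (λ n → seq x n * seq y n) (*-cauchy {seq x} {seq y} (cauchy x) (cauchy y))

-ᴿ_ : ℝ → ℝ
-ᴿ x = mkℝ (λ n → - seq x n) (neg-cauchy {seq x} (cauchy x))

_-ᴿ_ : ℝ → ℝ → ℝ
x -ᴿ y = x +ᴿ (-ᴿ y)

∑ : {A : Set} → List A → (A → ℝ) → ℝ
∑ xs f = foldr _+ᴿ_ 0ℝ (map f xs)

⟦_⟧ : {A : Set} → Dec A → ℝ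
⟦ a? ⟧ = if does a? then 1ℝ else 0ℝ

-- Coordinates range over Fin n, so they are the usual ones in {1,…,n}
-- lowered by 1; neither the order nor the difference of the two
-- coordinates is affected.
record P (n : ℕ) : Set where
  constructor ⟨_,_,_⟩
  field
    row      : Fin n
    col      : Fin n
    .row≤col : row Fin.≤ col

open P public

infix 4 _≤ᴾ_ _≤ᴾ?_ _≟ᴾ_

_≤ᴾ_ : ∀ {n} → P n → P n → Set
p ≤ᴾ q = row p Fin.≤ row q × col p Fin.≤ col q

_≤ᴾ?_ : ∀ {n} → Decidable (_≤ᴾ_ {n})
p ≤ᴾ? q = (row p Fin.≤? row q) ×-dec (col p Fin.≤? col q)

_≟ᴾ_ : ∀ {n} → DecidableEquality (P n)
⟨ i , j , _ ⟩ ≟ᴾ ⟨ i′ , j′ , _ ⟩ =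
  map′ (λ { (refl , refl) → refl }) (λ { refl → refl , refl })
       ((i Fin.≟ i′) ×-dec (j Fin.≟ j′))

toP : ∀ {n} → Fin n × Fin n → Maybe (P n)
toP (i , j) with i Fin.≤? j
... | yes i≤j = just ⟨ i , j , i≤j ⟩
... | no  _   = nothing

elements : ∀ n → List (P n)
elements n = mapMaybe toP (cartesianProduct (allFin n) (allFin n))

elements-complete : ∀ {n} (p : P n) → p ∈ˡ elements n
elements-complete p@(⟨ i , j , i≤j ⟩) =
  lift (∈-cartesianProduct⁺ (∈-allFin i) (∈-allFin j))
  where
  toP-just : toP (i , j) ≡ just p
  toP-just with i Fin.≤? j
  ... | yes _  = refl
  ... | no i≰j = contradiction-irr i≤j i≰j
  lift : ∀ {xs} → (i , j) ∈ˡ xs → p ∈ˡ mapMaybe toP xs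
  lift (here refl) rewrite toP-just = here refl
  lift {x ∷ _} (there ij∈) with toP x
  ... | just _  = there (lift ij∈)
  ... | nothing = lift ij∈

allP? : ∀ {n} {Q : Pred (P n) 0ℓ} → Decidable₁ Q → Dec (∀ p → Q p)
allP? {n} Q? = map′ (λ qs p → All.lookup qs (elements-complete p))
                    (λ q → All.universal q (elements n))
                    (All.all? Q? (elements n))

diagonal : ∀ n → ℕ → List (P n)
diagonal n k = filter (λ p → toℕ (col p) ∸ toℕ (row p) ℕ.≟ k) (elements n)

record 𝒥 (n : ℕ) : Set where
  field
    member     : P n → Bool
    downClosed : ∀ {p q} → p ≤ᴾ q → member q ≡ true → member p ≡ true

open 𝒥 public

infix 4 _∈_ _∉_ _∈?_ _∉?_

_∈_ _∉_ : ∀ {n} → P n → 𝒥 n → Set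
p ∈ I = member I p ≡ true
p ∉ I = ¬ p ∈ I

_∈?_ : ∀ {n} → Decidable (_∈_ {n})
p ∈? I = member I p Bool.≟ true

_∉?_ : ∀ {n} → Decidable (_∉_ {n})
p ∉? I = ¬? (p ∈? I)

MinimalIn MaximalIn : ∀ {n} → Pred (P n) 0ℓ → P n → Set
MinimalIn S p = S p × (∀ q → S q → q ≤ᴾ p → q ≡ p)
MaximalIn S p = S p × (∀ q → S q → p ≤ᴾ q → q ≡ p)

minimalIn? : ∀ {n} {S : Pred (P n) 0ℓ} → Decidable₁ S → Decidable₁ (MinimalIn S)
minimalIn? S? p = S? p ×-dec allP? λ q → S? q →-dec ((q ≤ᴾ? p) →-dec (q ≟ᴾ p))

maximalIn? : ∀ {n} {S : Pred (P n) 0ℓ} → Decidable₁ S → Decidable₁ (MaximalIn S)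
maximalIn? S? p = S? p ×-dec allP? λ q → S? q →-dec ((p ≤ᴾ? q) →-dec (q ≟ᴾ p))

𝟙 T⁺ T⁻ T : ∀ {n} → P n → 𝒥 n → ℝ
𝟙 x I  = ⟦ x ∈? I ⟧
T⁺ x I = ⟦ minimalIn? (_∉? I) x ⟧
T⁻ x I = ⟦ maximalIn? (_∈? I) x ⟧
T x I  = T⁺ x I -ᴿ T⁻ x I

infix 4 _≡ᵀ_

-- The relation f ≡ g of the toggleability statistics: equality modulo
-- real linear combinations of the functions T x.
_≡ᵀ_ : ∀ {n} → (𝒥 n → ℝ) → (𝒥 n → ℝ) → Set
_≡ᵀ_ {n} f g = Σ[ c ∈ (P n → ℝ) ] (∀ I → f I -ᴿ g I ≈ ∑ (elements n) (λ x → c x *ᴿ T x I))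

module Submission where

-- Let H d be the number of elements of I on the diagonal j − i = d, and S d the
-- sum of the T x over that diagonal. Extend the indicator of I to ℕ × ℕ by 0.
-- Pairing T⁺ at x + (1,1) with T⁻ at x makes the products of indicators cancel,
-- so every S d is affine in the H's:
--   S 0 = 1 − 2 (H 0 − H 1),   S (d + 1) = H d − 2 H (d + 1) + H (d + 2).
-- Hence H d − H (d + 1) − ½ is a combination of S 0, …, S d, and summing over
-- d = k, …, n − 1, with H n = 0, gives H k − (n − k)/2. The coefficients are
-- rational, so the identity holds exactly, at every index of the Cauchy sequences.

open import Defs
open import Data.Nat using (ℕ; _≤_; _∸_)
open import Data.Integer using (+_; _-_)
open import Data.Rational using (_/_)

open import Data.Bool using (Bool; true; false; not; _∧_; if_then_else_)
import Data.Bool.Properties as Bool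
open import Data.Bool.Properties using (¬-not; not-¬; ∧-conicalˡ; ∧-conicalʳ; ∧-identityʳ; ∧-zeroʳ)
open import Data.Empty using (⊥)
open import Data.Fin using (Fin; toℕ; fromℕ<)
import Data.Fin as Fin
open import Data.Fin.Properties using (toℕ-injective; toℕ-fromℕ<; toℕ<n)
import Data.Integer as ℤ
import Data.Integer.Properties as ℤ
import Data.Integer.Solver as ℤ
open import Data.List using (List; []; _∷_; _++_; map; mapMaybe; filter; allFin; tabulate; cartesianProduct)
open import Data.Maybe using (Maybe; just; nothing; maybe′)
open import Data.Nat using (zero; suc; _+_; _<_; _≤?_; _<?_; _≡ᵇ_; z≤n; s≤s; s≤s⁻¹)
import Data.Nat.Properties as ℕ
open import Data.Nat.Properties
  using (≤-refl; n≮n; <-≤-connex; ≤-trans; ≤-<-trans; <⇒≤; <⇒≱; n≤1+n; m≤n⇒m<n∨m≡n)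
open import Data.Product using (_×_; _,_; proj₁; proj₂; Σ-syntax; ∃-syntax)
open import Data.Rational using (ℚ; 0ℚ; 1ℚ; ½)
  renaming (_+_ to _+ℚ_; _-_ to _-ℚ_; -_ to -ℚ_; _*_ to _*ℚ_)
import Data.Rational as ℚ
import Data.Rational.Properties as ℚ
open import Data.Rational.Solver using (module +-*-Solver)
import Data.Rational.Unnormalised as ℚᵘ
import Data.Rational.Unnormalised.Properties as ℚᵘ
open import Data.Sum using (_⊎_; inj₁; inj₂; [_,_]′)
open import Function using (_∘_; id; _⇔_; mk⇔; Equivalence)
open import Level using (0ℓ)
open import Relation.Binary.PropositionalEquality
import Relation.Binary.Reasoning.Setoid as SetoidReasoning
open import Relation.Nullary using (¬_; Dec; yes; no; does; contradiction)
open import Relation.Nullary.Decidable using (dec-true; dec-false; decidable-stable; does-⇔)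
open import Relation.Nullary.Negation using (contradiction-irr)
open import Relation.Unary using (Pred; Decidable)

open +-*-Solver using (solve; con; _:=_; _:+_; _:*_; _:-_; :-_)

-- Ideals as indicator functions on ℕ × ℕ

P-≡ : ∀ {n} {p q : P n} → toℕ (row p) ≡ toℕ (row q) → toℕ (col p) ≡ toℕ (col q) → p ≡ q
P-≡ {p = ⟨ _ , _ , _ ⟩} {⟨ _ , _ , _ ⟩} i≡ j≡ with refl ← toℕ-injective i≡ | refl ← toℕ-injective j≡ = refl

-- The field `row≤col` is irrelevant, so it cannot be returned directly. Deciding the inequality
-- anew gives a usable proof, and the irrelevant one refutes the negative case.
row≤col-relevant : ∀ {n} (p : P n) → toℕ (row p) ≤ toℕ (col p)
row≤col-relevant ⟨ i , j , i≤j ⟩ with toℕ i ≤? toℕ j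
... | yes le = le
... | no  ≰  = contradiction-irr i≤j ≰

point : ∀ {n i j} → i ≤ j → j < n → ∃[ p ] (toℕ (row {n} p) ≡ i × toℕ (col p) ≡ j)
point {n} {i} {j} i≤j j<n = ⟨ fromℕ< i<n , fromℕ< j<n , subst₂ _≤_ (sym i≡) (sym j≡) i≤j ⟩ , i≡ , j≡
  where
  i<n = ≤-<-trans i≤j j<n
  i≡ = toℕ-fromℕ< i<n
  j≡ = toℕ-fromℕ< j<n

at : ∀ n → ℕ → ℕ → Maybe (P n)
at n i j with i ≤? j | j <? n
... | yes i≤j | yes j<n = just (proj₁ (point i≤j j<n))
... | _       | _       = nothing

at-toℕ : ∀ {n} (p : P n) → at n (toℕ (row p)) (toℕ (col p)) ≡ just p
at-toℕ {n} p with toℕ (row p) ≤? toℕ (col p) | toℕ (col p) <? n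
... | no i≰j  | _       = contradiction (row≤col-relevant p) i≰j
... | yes _   | no j≮n  = contradiction (toℕ<n (col p)) j≮n
... | yes i≤j | yes j<n = cong just (P-≡ (toℕ-fromℕ< _) (toℕ-fromℕ< _))

at-out : ∀ {n} i {j} → n ≤ j → at n i j ≡ nothing
at-out {n} i {j} n≤j with i ≤? j | j <? n
... | yes _ | yes j<n = contradiction n≤j (<⇒≱ j<n)
... | yes _ | no _    = refl
... | no _  | _       = refl

-- The default `z` is taken both below the diagonal and from column `n` onwards. It is a parameter
-- so that Boolean indicators and rational summands share one construction.
extend : ∀ {n} {B : Set} → B → (P n → B) → ℕ → ℕ → B
extend {n} z g i j = maybe′ g z (at n i j)

extend-toℕ : ∀ {n} {B : Set} {z : B} (g : P n → B) p → extend z g (toℕ (row p)) (toℕ (col p)) ≡ g p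
extend-toℕ g p rewrite at-toℕ p = refl

extend-out : ∀ {n} {B : Set} {z : B} (g : P n → B) i {j} → n ≤ j → extend z g i j ≡ z
extend-out g i n≤j rewrite at-out i n≤j = refl

module _ {n} (I : 𝒥 n) where

  mem : ℕ → ℕ → Bool
  mem = extend false (member I)

  t⁺ t⁻ : P n → Bool
  t⁺ p = does (minimalIn? (_∉? I) p)
  t⁻ p = does (maximalIn? (_∈? I) p)

  mem⇒inRange : ∀ {i j} → mem i j ≡ true → i ≤ j × j < n
  mem⇒inRange {i} {j} eq with i ≤? j | j <? n
  ... | yes i≤j | yes j<n = i≤j , j<n
  mem⇒inRange () | yes _ | no _
  mem⇒inRange () | no _ | _

  mem-toℕ : ∀ p → mem (toℕ (row p)) (toℕ (col p)) ≡ member I p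
  mem-toℕ = extend-toℕ (member I)

  mem⇒∃∈ : ∀ {i j} → mem i j ≡ true → ∃[ p ] (toℕ (row p) ≡ i × toℕ (col p) ≡ j × p ∈ I)
  mem⇒∃∈ {i} {j} eq = let i≤j , j<n = mem⇒inRange {i} eq in go (point i≤j j<n)
    where
    go : ∃[ p ] (toℕ (row p) ≡ i × toℕ (col p) ≡ j) → ∃[ p ] (toℕ (row p) ≡ i × toℕ (col p) ≡ j × p ∈ I)
    go (p , refl , refl) = p , refl , refl , trans (sym (mem-toℕ p)) eq

  -- The larger point is in `I`, hence in `P`, which bounds both columns by `n`. That the smaller
  -- point is in `P` still needs `i ≤ j`, because `mem` is false below the diagonal.
  mem-↓ : ∀ {i j i′ j′} → i ≤ j → i ≤ i′ → j ≤ j′ → mem i′ j′ ≡ true → mem i j ≡ true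
  mem-↓ {i} {j} {i′} {j′} i≤j i≤i′ j≤j′ eq with mem⇒∃∈ {i′} eq
  ... | q , refl , refl , q∈I with point i≤j (≤-<-trans j≤j′ (toℕ<n (col q)))
  ...   | p , refl , refl = trans (mem-toℕ p) (downClosed I (i≤i′ , j≤j′) q∈I)

  -- The two conditions are not mirror images: points outside `P` count as non-members, which is
  -- harmless for `Above⊈` but would falsify `Below⊆`, so the latter is restricted to `i′ ≤ j′`.
  Below⊆ Above⊈ : ℕ → ℕ → Set
  Below⊆ i j = ∀ i′ j′ → i′ ≤ j′ → i′ ≤ i → j′ ≤ j → i′ < i ⊎ j′ < j → mem i′ j′ ≡ true
  Above⊈ i j = ∀ i′ j′ → i ≤ i′ → j ≤ j′ → i < i′ ⊎ j < j′ → mem i′ j′ ≡ false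

  minimal⇔ : ∀ q → MinimalIn (_∉ I) q ⇔ (q ∉ I × Below⊆ (toℕ (row q)) (toℕ (col q)))
  minimal⇔ q = mk⇔ to from
    where
    to : MinimalIn (_∉ I) q → q ∉ I × Below⊆ (toℕ (row q)) (toℕ (col q))
    to (q∉I , min) = q∉I , below
      where
      below : Below⊆ (toℕ (row q)) (toℕ (col q))
      below _ _ i≤j i≤ j≤ lt with point i≤j (≤-<-trans j≤ (toℕ<n (col q)))
      -- If `p` were outside `I`, minimality would identify it with `q`, and the strict inequality
      -- in one coordinate would become irreflexive.
      ... | p , refl , refl = trans (mem-toℕ p) (decidable-stable (p ∈? I) λ p∉I →
              [ n≮n _ , n≮n _ ]′ (subst (λ p → toℕ (row p) < _ ⊎ toℕ (col p) < _) (min p p∉I (i≤ , j≤)) lt))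
    from : q ∉ I × Below⊆ (toℕ (row q)) (toℕ (col q)) → MinimalIn (_∉ I) q
    from (q∉I , below) = q∉I , min
      where
      min : ∀ p → p ∉ I → p ≤ᴾ q → p ≡ q
      min p p∉I (i≤ , j≤) with m≤n⇒m<n∨m≡n i≤ | m≤n⇒m<n∨m≡n j≤
      ... | inj₂ i≡ | inj₂ j≡ = P-≡ i≡ j≡
      ... | inj₁ i< | _       = contradiction (trans (sym (mem-toℕ p)) (below _ _ (row≤col-relevant p) i≤ j≤ (inj₁ i<))) p∉I
      ... | _       | inj₁ j< = contradiction (trans (sym (mem-toℕ p)) (below _ _ (row≤col-relevant p) i≤ j≤ (inj₂ j<))) p∉I

  maximal⇔ : ∀ q → MaximalIn (_∈ I) q ⇔ (q ∈ I × Above⊈ (toℕ (row q)) (toℕ (col q)))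
  maximal⇔ q = mk⇔ to from
    where
    to : MaximalIn (_∈ I) q → q ∈ I × Above⊈ (toℕ (row q)) (toℕ (col q))
    to (q∈I , max) = q∈I , above
      where
      above : Above⊈ (toℕ (row q)) (toℕ (col q))
      above i′ j′ i≤ j≤ lt = ¬-not λ eq → beyond (mem⇒∃∈ {i′} eq)
        where
        beyond : ∃[ p ] (toℕ (row p) ≡ i′ × toℕ (col p) ≡ j′ × p ∈ I) → ⊥
        beyond (p , refl , refl , p∈I) =
          [ n≮n _ , n≮n _ ]′ (subst (λ p → _ < toℕ (row p) ⊎ _ < toℕ (col p)) (max p p∈I (i≤ , j≤)) lt)
    from : q ∈ I × Above⊈ (toℕ (row q)) (toℕ (col q)) → MaximalIn (_∈ I) q
    from (q∈I , above) = q∈I , max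
      where
      max : ∀ p → p ∈ I → q ≤ᴾ p → p ≡ q
      max p p∈I (i≤ , j≤) with m≤n⇒m<n∨m≡n i≤ | m≤n⇒m<n∨m≡n j≤
      ... | inj₂ i≡ | inj₂ j≡ = P-≡ (sym i≡) (sym j≡)
      ... | inj₁ i< | _       = contradiction (trans (mem-toℕ p) p∈I) (not-¬ (above _ _ i≤ j≤ (inj₁ i<)))
      ... | _       | inj₁ j< = contradiction (trans (mem-toℕ p) p∈I) (not-¬ (above _ _ i≤ j≤ (inj₂ j<)))

  -- Toggleability read off from neighbouring indicator values

  canAdd canRemove : ℕ → ℕ → Bool
  canAdd = extend false t⁺
  canRemove = extend false t⁻

  -- Minimality quantifies over all of `P`. Replacing that condition by any Boolean `u` equivalent
  -- to it leaves each position only the task of naming the lower neighbours that suffice.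
  canAdd-∧ : ∀ {i j u} → i ≤ j → j < n → (u ≡ true ⇔ Below⊆ i j) → canAdd i j ≡ not (mem i j) ∧ u
  canAdd-∧ {u = u} i≤j j<n u⇔ with point i≤j j<n
  ... | q , refl , refl = trans (extend-toℕ t⁺ q) (trans (does-∧ (member I q) refl u u⇔) (cong (λ b → not b ∧ u) (sym (mem-toℕ q))))
    where
    does-∧ : ∀ b → member I q ≡ b → ∀ u → (u ≡ true ⇔ Below⊆ (toℕ (row q)) (toℕ (col q))) → t⁺ q ≡ not b ∧ u
    does-∧ true  eq _     _  = dec-false (minimalIn? (_∉? I) q) λ (q∉I , _) → q∉I eq
    does-∧ false eq true  u⇔ = dec-true (minimalIn? (_∉? I) q)
      (Equivalence.from (minimal⇔ q) (not-¬ eq , Equivalence.to u⇔ refl))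
    does-∧ false eq false u⇔ = dec-false (minimalIn? (_∉? I) q) λ min →
      contradiction (Equivalence.from u⇔ (proj₂ (Equivalence.to (minimal⇔ q) min))) λ ()

  canRemove-∧ : ∀ {i j u} → i ≤ j → j < n → (u ≡ true ⇔ Above⊈ i j) → canRemove i j ≡ mem i j ∧ u
  canRemove-∧ {u = u} i≤j j<n u⇔ with point i≤j j<n
  ... | q , refl , refl = trans (extend-toℕ t⁻ q) (trans (does-∧ (member I q) refl u u⇔) (cong (_∧ u) (sym (mem-toℕ q))))
    where
    does-∧ : ∀ b → member I q ≡ b → ∀ u → (u ≡ true ⇔ Above⊈ (toℕ (row q)) (toℕ (col q))) → t⁻ q ≡ b ∧ u
    does-∧ false eq _     _  = dec-false (maximalIn? (_∈? I) q) λ (q∈I , _) → not-¬ eq q∈I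
    does-∧ true  eq true  u⇔ = dec-true (maximalIn? (_∈? I) q)
      (Equivalence.from (maximal⇔ q) (eq , Equivalence.to u⇔ refl))
    does-∧ true  eq false u⇔ = dec-false (maximalIn? (_∈? I) q) λ max →
      contradiction (Equivalence.from u⇔ (proj₂ (Equivalence.to (maximal⇔ q) max))) λ ()

  canAdd-out : ∀ i {j} → n ≤ j → canAdd i j ≡ false
  canAdd-out i = extend-out t⁺ i

  mem-out : ∀ i {j} → n ≤ j → mem i j ≡ false
  mem-out i = extend-out (member I) i

  canRemove-out : ∀ i {j} → n ≤ j → canRemove i j ≡ false
  canRemove-out i = extend-out t⁻ i

  canAdd-origin : 0 < n → canAdd 0 0 ≡ not (mem 0 0)
  canAdd-origin 0<n = trans (canAdd-∧ z≤n 0<n (mk⇔ (λ { _ _ _ _ _ _ (inj₁ ()) ; _ _ _ _ _ _ (inj₂ ()) }) (λ _ → refl))) (∧-identityʳ _)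

  canAdd-top : ∀ {j} → suc j < n → canAdd 0 (suc j) ≡ not (mem 0 (suc j)) ∧ mem 0 j
  canAdd-top j<n = canAdd-∧ z≤n j<n (mk⇔
    (λ { eq _ _ i≤j i≤ j≤ (inj₂ j<) → mem-↓ i≤j i≤ (s≤s⁻¹ j<) eq })
    (λ below → below _ _ z≤n z≤n (n≤1+n _) (inj₂ ≤-refl)))

  -- The neighbour `(i+1, i)` is not in `P`: a point of `P` strictly below `(i+1, i+1)` has row at
  -- most `i`, hence lies below `(i, i+1)`.
  canAdd-diagonal : ∀ i → canAdd (suc i) (suc i) ≡ not (mem (suc i) (suc i)) ∧ mem i (suc i)
  canAdd-diagonal i with <-≤-connex (suc i) n
  -- Beyond the last column both sides are false, so the formula holds in every row and can be used
  -- under a sum without splitting the range.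
  ... | inj₂ n≤j rewrite canAdd-out (suc i) n≤j | mem-out i n≤j = sym (∧-zeroʳ _)
  ... | inj₁ j<n = canAdd-∧ ≤-refl j<n (mk⇔
    (λ eq _ _ i≤j i≤ j≤ lt → mem-↓ i≤j ([ s≤s⁻¹ , (λ j< → ≤-trans i≤j (s≤s⁻¹ j<)) ]′ lt) j≤ eq)
    (λ below → below _ _ (n≤1+n i) (n≤1+n i) ≤-refl (inj₁ ≤-refl)))

  -- Here `i < j` puts `(i+1, j)` into `P`, so there are two lower neighbours, and every point of
  -- `P` strictly below `(i+1, j+1)` lies below one of them.
  canAdd-interior : ∀ {i j} → i < j → canAdd (suc i) (suc j) ≡ not (mem (suc i) (suc j)) ∧ mem i (suc j) ∧ mem (suc i) j
  canAdd-interior {i} {j} i<j with <-≤-connex (suc j) n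
  ... | inj₂ n≤j rewrite canAdd-out (suc i) n≤j | mem-out i n≤j = sym (∧-zeroʳ _)
  ... | inj₁ j<n = canAdd-∧ (<⇒≤ (s≤s i<j)) j<n (mk⇔
    (λ eq _ _ i≤j i≤ j≤ → λ
      { (inj₁ i<) → mem-↓ i≤j (s≤s⁻¹ i<) j≤ (∧-conicalˡ _ _ eq)
      ; (inj₂ j<) → mem-↓ i≤j i≤ (s≤s⁻¹ j<) (∧-conicalʳ (mem i (suc j)) _ eq) })
    (λ below → cong₂ _∧_
      (below _ _ (≤-trans (<⇒≤ i<j) (n≤1+n j)) (n≤1+n i) ≤-refl (inj₁ ≤-refl))
      (below _ _ i<j ≤-refl (n≤1+n j) (inj₂ ≤-refl))))

  -- A point of `I` strictly above `(i, i)` has column at least `i+1`, so it lies above `(i, i+1)`.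
  -- In the last column that neighbour falls outside `P`, where `mem` is false, and the formula
  -- remains correct.
  canRemove-diagonal : ∀ i → canRemove i i ≡ mem i i ∧ not (mem i (suc i))
  canRemove-diagonal i with <-≤-connex i n
  ... | inj₂ n≤j rewrite canRemove-out i n≤j | mem-out i n≤j = refl
  ... | inj₁ j<n = canRemove-∧ ≤-refl j<n (mk⇔
    (λ eq i′ _ i≤ j≤ lt → ¬-not λ eq′ → not-¬ eq (cong not
      (mem-↓ (n≤1+n i) i≤ ([ (λ i< → ≤-trans i< (proj₁ (mem⇒inRange {i′} eq′))) , id ]′ lt) eq′)))
    (λ above → cong not (above _ _ ≤-refl (n≤1+n i) (inj₂ ≤-refl))))

  canRemove-interior : ∀ {i j} → i < j → canRemove i j ≡ mem i j ∧ not (mem i (suc j)) ∧ not (mem (suc i) j)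
  canRemove-interior {i} {j} i<j with <-≤-connex j n
  ... | inj₂ n≤j rewrite canRemove-out i n≤j | mem-out i n≤j = refl
  ... | inj₁ j<n = canRemove-∧ (<⇒≤ i<j) j<n (mk⇔
    (λ eq _ _ i≤ j≤ → λ
      { (inj₁ i<) → ¬-not λ eq′ → not-¬ (∧-conicalʳ (not (mem i (suc j))) _ eq) (cong not (mem-↓ i<j i< j≤ eq′))
      ; (inj₂ j<) → ¬-not λ eq′ → not-¬ (∧-conicalˡ _ _ eq) (cong not (mem-↓ (≤-trans (<⇒≤ i<j) (n≤1+n j)) i≤ j< eq′)) })
    (λ above → cong₂ (λ b c → not b ∧ not c)
      (above _ _ ≤-refl (n≤1+n j) (inj₂ ≤-refl))
      (above _ _ (n≤1+n i) ≤-refl (inj₁ ≤-refl))))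

-- Finite sums of rationals

ι : Bool → ℚ
ι b = if b then 1ℚ else 0ℚ

-- The four bits sit on a unit square with least corner `x` and greatest corner `e`, decreasing
-- upwards. By monotonicity the two products expand to `bc - e` and `x - b - c + bc`, and the
-- quadratic term `bc` cancels.
ι-interior : ∀ x b c e → (e ≡ true → b ≡ true) → (e ≡ true → c ≡ true) →
             (b ≡ true → x ≡ true) → (c ≡ true → x ≡ true) →
             ι (not e ∧ b ∧ c) -ℚ ι (x ∧ not b ∧ not c) ≡ ((ι b +ℚ ι c) -ℚ ι x) -ℚ ι e
ι-interior true  true  true  true  _ _ _ _ = refl
ι-interior true  true  true  false _ _ _ _ = refl
ι-interior true  true  false false _ _ _ _ = refl
ι-interior true  false true  false _ _ _ _ = refl
ι-interior true  false false false _ _ _ _ = refl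
ι-interior false false false false _ _ _ _ = refl
ι-interior _     false _     true  p _ _ _ with () ← p refl
ι-interior _     _     false true  _ p _ _ with () ← p refl
ι-interior false true  _     _     _ _ p _ with () ← p refl
ι-interior false _     true  _     _ _ _ p with () ← p refl

-- This is the interior identity with `c = b`: on the main diagonal the missing corner acts as the
-- mirror image of `b`, which is therefore counted twice.
ι-diagonal : ∀ x b e → (e ≡ true → b ≡ true) → (b ≡ true → x ≡ true) →
             ι (not e ∧ b) -ℚ ι (x ∧ not b) ≡ ((ι b +ℚ ι b) -ℚ ι x) -ℚ ι e
ι-diagonal true  true  true  _ _ = refl
ι-diagonal true  true  false _ _ = refl
ι-diagonal true  false false _ _ = refl
ι-diagonal false false false _ _ = refl
ι-diagonal _     false true  p _ with () ← p refl
ι-diagonal false true  _     _ p with () ← p refl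

ι-top : ∀ x e → (e ≡ true → x ≡ true) → ι (not e ∧ x) ≡ ι x -ℚ ι e
ι-top true  true  _ = refl
ι-top true  false _ = refl
ι-top false false _ = refl
ι-top false true  p with () ← p refl

ι-not : ∀ x → ι (not x) ≡ 1ℚ -ℚ ι x
ι-not true  = refl
ι-not false = refl

∑ᴸ : {A : Set} → List A → (A → ℚ) → ℚ
∑ᴸ []       f = 0ℚ
∑ᴸ (x ∷ xs) f = f x +ℚ ∑ᴸ xs f

∑< : ℕ → (ℕ → ℚ) → ℚ
∑< zero    f = 0ℚ
∑< (suc n) f = f 0 +ℚ ∑< n (f ∘ suc)

∑ᴸ-cong : ∀ {A : Set} (xs : List A) {f g : A → ℚ} → (∀ x → f x ≡ g x) → ∑ᴸ xs f ≡ ∑ᴸ xs g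
∑ᴸ-cong []       f≡g = refl
∑ᴸ-cong (x ∷ xs) f≡g = cong₂ _+ℚ_ (f≡g x) (∑ᴸ-cong xs f≡g)

∑ᴸ-++ : ∀ {A : Set} (xs ys : List A) f → ∑ᴸ (xs ++ ys) f ≡ ∑ᴸ xs f +ℚ ∑ᴸ ys f
∑ᴸ-++ []       ys f = sym (ℚ.+-identityˡ _)
∑ᴸ-++ (x ∷ xs) ys f = trans (cong (f x +ℚ_) (∑ᴸ-++ xs ys f)) (sym (ℚ.+-assoc (f x) _ _))

∑ᴸ-map : ∀ {A B : Set} (h : A → B) xs f → ∑ᴸ (map h xs) f ≡ ∑ᴸ xs (f ∘ h)
∑ᴸ-map h []       f = refl
∑ᴸ-map h (x ∷ xs) f = cong (f (h x) +ℚ_) (∑ᴸ-map h xs f)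

∑ᴸ-0 : ∀ {A : Set} (xs : List A) → ∑ᴸ xs (λ _ → 0ℚ) ≡ 0ℚ
∑ᴸ-0 []       = refl
∑ᴸ-0 (x ∷ xs) = trans (ℚ.+-identityˡ _) (∑ᴸ-0 xs)

∑ᴸ-+ : ∀ {A : Set} (xs : List A) f g → ∑ᴸ xs (λ x → f x +ℚ g x) ≡ ∑ᴸ xs f +ℚ ∑ᴸ xs g
∑ᴸ-+ []       f g = refl
∑ᴸ-+ (x ∷ xs) f g = trans (cong (f x +ℚ g x +ℚ_) (∑ᴸ-+ xs f g))
  (solve 4 (λ a b c d → a :+ b :+ (c :+ d) := a :+ c :+ (b :+ d)) refl (f x) (g x) (∑ᴸ xs f) (∑ᴸ xs g))

∑ᴸ-* : ∀ {A : Set} (xs : List A) r f → ∑ᴸ xs (λ x → r *ℚ f x) ≡ r *ℚ ∑ᴸ xs f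
∑ᴸ-* []       r f = sym (ℚ.*-zeroʳ r)
∑ᴸ-* (x ∷ xs) r f = trans (cong (r *ℚ f x +ℚ_) (∑ᴸ-* xs r f)) (sym (ℚ.*-distribˡ-+ r _ _))

∑ᴸ-filter : ∀ {A : Set} {Q : Pred A 0ℓ} (Q? : Decidable Q) xs f →
            ∑ᴸ (filter Q? xs) f ≡ ∑ᴸ xs (λ x → ι (does (Q? x)) *ℚ f x)
∑ᴸ-filter Q? []       f = refl
∑ᴸ-filter Q? (x ∷ xs) f with does (Q? x)
... | true  = cong₂ _+ℚ_ (sym (ℚ.*-identityˡ (f x))) (∑ᴸ-filter Q? xs f)
... | false = trans (∑ᴸ-filter Q? xs f) (sym (trans (cong (_+ℚ _) (ℚ.*-zeroˡ (f x))) (ℚ.+-identityˡ _)))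

∑ᴸ-cartesianProduct : ∀ {A B : Set} (xs : List A) (ys : List B) f →
                      ∑ᴸ (cartesianProduct xs ys) f ≡ ∑ᴸ xs (λ x → ∑ᴸ ys (λ y → f (x , y)))
∑ᴸ-cartesianProduct []       ys f = refl
∑ᴸ-cartesianProduct (x ∷ xs) ys f = trans (∑ᴸ-++ (map (x ,_) ys) _ f)
  (cong₂ _+ℚ_ (∑ᴸ-map (x ,_) ys f) (∑ᴸ-cartesianProduct xs ys f))

∑<-cong : ∀ n {f g : ℕ → ℚ} → (∀ i → f i ≡ g i) → ∑< n f ≡ ∑< n g
∑<-cong zero    f≡g = refl
∑<-cong (suc n) f≡g = cong₂ _+ℚ_ (f≡g 0) (∑<-cong n (f≡g ∘ suc))

∑<-0 : ∀ n {f : ℕ → ℚ} → (∀ i → f i ≡ 0ℚ) → ∑< n f ≡ 0ℚ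
∑<-0 zero    f≡0 = refl
∑<-0 (suc n) f≡0 = cong₂ _+ℚ_ (f≡0 0) (∑<-0 n (f≡0 ∘ suc))

∑<-+ : ∀ n f g → ∑< n (λ i → f i +ℚ g i) ≡ ∑< n f +ℚ ∑< n g
∑<-+ zero    f g = refl
∑<-+ (suc n) f g = trans (cong (f 0 +ℚ g 0 +ℚ_) (∑<-+ n (f ∘ suc) (g ∘ suc)))
  (solve 4 (λ a b c d → a :+ b :+ (c :+ d) := a :+ c :+ (b :+ d)) refl (f 0) (g 0) (∑< n (f ∘ suc)) (∑< n (g ∘ suc)))

∑<-neg : ∀ n f → ∑< n (λ i → -ℚ f i) ≡ -ℚ ∑< n f
∑<-neg zero    f = refl
∑<-neg (suc n) f = trans (cong (-ℚ f 0 +ℚ_) (∑<-neg n (f ∘ suc))) (sym (ℚ.neg-distrib-+ (f 0) _))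

∑<-- : ∀ n f g → ∑< n (λ i → f i -ℚ g i) ≡ ∑< n f -ℚ ∑< n g
∑<-- n f g = trans (∑<-+ n f _) (cong (∑< n f +ℚ_) (∑<-neg n g))

∑<-linear : ∀ n (f g h k : ℕ → ℚ) → ∑< n (λ i → ((f i +ℚ g i) -ℚ h i) -ℚ k i)
                                ≡ ((∑< n f +ℚ ∑< n g) -ℚ ∑< n h) -ℚ ∑< n k
∑<-linear n f g h k = trans (∑<-- n _ k) (cong (_-ℚ _) (trans (∑<-- n _ h) (cong (_-ℚ _) (∑<-+ n f g))))

∑<-last : ∀ n f → ∑< (suc n) f ≡ ∑< n f +ℚ f n
∑<-last zero    f = ℚ.+-comm (f 0) 0ℚ
∑<-last (suc n) f = trans (cong (f 0 +ℚ_) (∑<-last n (f ∘ suc))) (sym (ℚ.+-assoc (f 0) _ _))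

∑<-shift : ∀ n f → f n ≡ 0ℚ → ∑< n (f ∘ suc) ≡ ∑< n f -ℚ f 0
∑<-shift n f fn≡0 = begin
  ∑< n (f ∘ suc)               ≡⟨ solve 2 (λ a s → s := a :+ s :- a) refl (f 0) (∑< n (f ∘ suc)) ⟩
  ∑< (suc n) f -ℚ f 0          ≡⟨ cong (_-ℚ f 0) (∑<-last n f) ⟩
  (∑< n f +ℚ f n) -ℚ f 0       ≡⟨ cong (λ z → (∑< n f +ℚ z) -ℚ f 0) fn≡0 ⟩
  (∑< n f +ℚ 0ℚ) -ℚ f 0        ≡⟨ cong (_-ℚ f 0) (ℚ.+-identityʳ (∑< n f)) ⟩
  ∑< n f -ℚ f 0                ∎
  where open ≡-Reasoning

-- The selected index may lie past the range of summation; the last hypothesis makes the value there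
-- zero, so the formula needs no bound on `t`.
∑<-δ : ∀ n t (f : ℕ → ℚ) → (n ≤ t → f t ≡ 0ℚ) → ∑< n (λ j → ι (j ≡ᵇ t) *ℚ f j) ≡ f t
∑<-δ zero    t       f out = sym (out z≤n)
∑<-δ (suc n) zero    f out = trans
  (cong₂ _+ℚ_ (ℚ.*-identityˡ (f 0)) (∑<-0 n (λ i → ℚ.*-zeroˡ (f (suc i))))) (ℚ.+-identityʳ _)
∑<-δ (suc n) (suc t) f out = trans
  (cong₂ _+ℚ_ (ℚ.*-zeroˡ (f 0)) (∑<-δ n t (f ∘ suc) (out ∘ s≤s))) (ℚ.+-identityˡ (f (suc t)))

∑ᴸ-tabulate : ∀ {A : Set} n (h : Fin n → A) (f : A → ℚ) (g : ℕ → ℚ) →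
              (∀ i → f (h i) ≡ g (toℕ i)) → ∑ᴸ (tabulate h) f ≡ ∑< n g
∑ᴸ-tabulate zero    h f g eq = refl
∑ᴸ-tabulate (suc n) h f g eq =
  cong₂ _+ℚ_ (eq Fin.zero) (∑ᴸ-tabulate n (h ∘ Fin.suc) f (g ∘ suc) (eq ∘ Fin.suc))

∑ᴸ-allFin : ∀ n (g : ℕ → ℚ) → ∑ᴸ (allFin n) (g ∘ toℕ) ≡ ∑< n g
∑ᴸ-allFin n g = ∑ᴸ-tabulate n _ (g ∘ toℕ) g (λ _ → refl)

-- Sums along a diagonal

toP-just : ∀ {n} ij {p : P n} → toP ij ≡ just p → row p ≡ proj₁ ij × col p ≡ proj₂ ij
toP-just (i , j) eq with i Fin.≤? j
toP-just _ refl | yes _ = refl , refl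

toP-nothing : ∀ {n} (ij : Fin n × Fin n) → toP ij ≡ nothing → ¬ proj₁ ij Fin.≤ proj₂ ij
toP-nothing (i , j) eq with i Fin.≤? j
... | no i≰j = i≰j

onDiagonal? : ∀ {n} e → Decidable (λ (p : P n) → toℕ (col p) ∸ toℕ (row p) ≡ e)
onDiagonal? e p = toℕ (col p) ∸ toℕ (row p) ℕ.≟ e

-- The filter becomes an indicator weight, the list of elements becomes a double sum over the
-- square, and the inner sum selects the column `i + e`. Rows whose selected column leaves `P`
-- contribute the default zero.
∑-diagonal : ∀ n e (g : P n → ℚ) → ∑ᴸ (diagonal n e) g ≡ ∑< n (λ i → extend 0ℚ g i (i + e))
∑-diagonal n e g = begin
  ∑ᴸ (diagonal n e) g
    ≡⟨ ∑ᴸ-filter (onDiagonal? e) (elements n) g ⟩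
  ∑ᴸ (elements n) (λ p → ι (does (onDiagonal? e p)) *ℚ g p)
    ≡⟨ mapped (cartesianProduct (allFin n) (allFin n)) ⟩
  ∑ᴸ (cartesianProduct (allFin n) (allFin n)) (λ ij → φ (toℕ (proj₁ ij)) (toℕ (proj₂ ij)))
    ≡⟨ ∑ᴸ-cartesianProduct (allFin n) (allFin n) _ ⟩
  ∑ᴸ (allFin n) (λ i → ∑ᴸ (allFin n) (λ j → φ (toℕ i) (toℕ j)))
    ≡⟨ ∑ᴸ-cong (allFin n) (λ i → ∑ᴸ-allFin n (φ (toℕ i))) ⟩
  ∑ᴸ (allFin n) (λ i → ∑< n (φ (toℕ i)))
    ≡⟨ ∑ᴸ-allFin n (λ i → ∑< n (φ i)) ⟩
  ∑< n (λ i → ∑< n (φ i))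
    ≡⟨ ∑<-cong n (λ i → ∑<-δ n (i + e) (extend 0ℚ g i) (extend-out g i)) ⟩
  ∑< n (λ i → extend 0ℚ g i (i + e))
    ∎
  where
  open ≡-Reasoning
  φ : ℕ → ℕ → ℚ
  φ i j = ι (j ≡ᵇ i + e) *ℚ extend 0ℚ g i j

  on : ∀ p → ι (does (onDiagonal? e p)) *ℚ g p ≡ φ (toℕ (row p)) (toℕ (col p))
  on p = cong₂ (λ b x → ι b *ℚ x)
    -- Truncated subtraction is inverted here by `row ≤ col`, so that the weight compares the column
    -- with `row + e`.
    (does-⇔ (mk⇔ (λ eq → trans (sym (ℕ.m+[n∸m]≡n (row≤col-relevant p))) (cong (λ d → toℕ (row p) + d) eq))
                  (λ eq → trans (cong (_∸ toℕ (row p)) eq) (ℕ.m+n∸m≡n (toℕ (row p)) e)))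
            (onDiagonal? e p) (toℕ (col p) ℕ.≟ toℕ (row p) + e))
    (sym (extend-toℕ g p))

  mapped : ∀ xs → ∑ᴸ (mapMaybe toP xs) (λ p → ι (does (onDiagonal? e p)) *ℚ g p)
                ≡ ∑ᴸ xs (λ ij → φ (toℕ (proj₁ ij)) (toℕ (proj₂ ij)))
  mapped []             = refl
  mapped ((i , j) ∷ xs) with toP (i , j) in eq
  ... | just p  with refl , refl ← toP-just (i , j) eq = cong₂ _+ℚ_ (on p) (mapped xs)
  -- A pair rejected by `toP` has column less than row, so its column cannot be `i + e`; the term it
  -- adds to the double sum has weight zero.
  ... | nothing = trans (mapped xs) (sym (trans
    (cong (_+ℚ _) (trans (cong (λ b → ι b *ℚ extend 0ℚ g (toℕ i) (toℕ j)) (dec-false (toℕ j ℕ.≟ toℕ i + e)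
      (λ j≡ → toP-nothing (i , j) eq (ℕ.m+n≤o⇒m≤o _ (ℕ.≤-reflexive (sym j≡))))))
      (ℚ.*-zeroˡ (extend 0ℚ g (toℕ i) (toℕ j)))))
    (ℚ.+-identityˡ _)))

-- Diagonal sums of the `T x` as affine functions of the diagonal counts

module _ {n} (I : 𝒥 n) where

  χ : ℕ → ℕ → ℚ
  χ i j = ι (mem I i j)

  H : ℕ → ℚ
  H d = ∑< n (λ i → χ i (i + d))

  t : P n → ℚ
  t p = ι (t⁺ I p) -ℚ ι (t⁻ I p)

  S : ℕ → ℚ
  S d = ∑ᴸ (diagonal n d) t

  extend-t : ∀ i j → extend 0ℚ t i j ≡ ι (canAdd I i j) -ℚ ι (canRemove I i j)
  extend-t i j with at n i j
  ... | just _  = refl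
  ... | nothing = refl

  χ-out : ∀ i {j} → n ≤ j → χ i j ≡ 0ℚ
  χ-out i n≤j = cong ι (mem-out I i n≤j)

  square-interior : ∀ {i j} → i < j → ι (canAdd I (suc i) (suc j)) -ℚ ι (canRemove I i j)
                                   ≡ ((χ i (suc j) +ℚ χ (suc i) j) -ℚ χ i j) -ℚ χ (suc i) (suc j)
  square-interior {i} {j} i<j rewrite canAdd-interior I i<j | canRemove-interior I i<j =
    ι-interior (mem I i j) (mem I i (suc j)) (mem I (suc i) j) (mem I (suc i) (suc j))
      (mem-↓ I (ℕ.≤-trans i≤j (ℕ.n≤1+n j)) (ℕ.n≤1+n i) ℕ.≤-refl) (mem-↓ I i<j ℕ.≤-refl (ℕ.n≤1+n j))
      (mem-↓ I i≤j ℕ.≤-refl (ℕ.n≤1+n j)) (mem-↓ I i≤j (ℕ.n≤1+n i) ℕ.≤-refl)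
    where i≤j = ℕ.<⇒≤ i<j

  square-diagonal : ∀ i → ι (canAdd I (suc i) (suc i)) -ℚ ι (canRemove I i i)
                        ≡ ((χ i (suc i) +ℚ χ i (suc i)) -ℚ χ i i) -ℚ χ (suc i) (suc i)
  square-diagonal i rewrite canAdd-diagonal I i | canRemove-diagonal I i =
    ι-diagonal (mem I i i) (mem I i (suc i)) (mem I (suc i) (suc i))
      (mem-↓ I (ℕ.n≤1+n i) (ℕ.n≤1+n i) ℕ.≤-refl) (mem-↓ I ℕ.≤-refl ℕ.≤-refl (ℕ.n≤1+n i))

  -- The positive part in row `i+1` is matched with the negative part in row `i`, the opposite
  -- corner of a unit square. Only the positive part in row 0 is left without a partner.
  S-paired : ∀ d → S d ≡ ι (canAdd I 0 d) +ℚ ∑< n (λ i → ι (canAdd I (suc i) (suc i + d)) -ℚ ι (canRemove I i (i + d)))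
  S-paired d = begin
    S d
      ≡⟨ ∑-diagonal n d t ⟩
    ∑< n (λ i → extend 0ℚ t i (i + d))
      ≡⟨ ∑<-cong n (λ i → extend-t i (i + d)) ⟩
    ∑< n (λ i → p i -ℚ q i)
      ≡⟨ ∑<-- n p q ⟩
    ∑< n p -ℚ ∑< n q
      ≡⟨ solve 3 (λ x y z → x :- z := y :+ ((x :- y) :- z)) refl (∑< n p) (p 0) (∑< n q) ⟩
    p 0 +ℚ ((∑< n p -ℚ p 0) -ℚ ∑< n q)
      -- The shift brings in row `n`, whose column `n + d` is out of range, so its term is zero.
      ≡⟨ cong (λ s → p 0 +ℚ (s -ℚ ∑< n q)) (∑<-shift n p (cong ι (canAdd-out I n (ℕ.m≤m+n n d)))) ⟨
    p 0 +ℚ (∑< n (p ∘ suc) -ℚ ∑< n q)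
      ≡⟨ cong (p 0 +ℚ_) (∑<-- n (p ∘ suc) q) ⟨
    p 0 +ℚ ∑< n (λ i → p (suc i) -ℚ q i)
      ∎
    where
    open ≡-Reasoning
    p q : ℕ → ℚ
    p i = ι (canAdd I i (i + d))
    q i = ι (canRemove I i (i + d))

  H-shift : ∀ d → ∑< n (λ i → χ (suc i) (suc i + d)) ≡ H d -ℚ χ 0 d
  H-shift d = ∑<-shift n (λ i → χ i (i + d)) (χ-out n (ℕ.m≤m+n n d))

  -- In each square one corner lies on diagonal `d`, one on `d+2` and two on `d+1`. Starting from
  -- row 1 instead of row 0 loses `χ 0 d` and `χ 0 (suc d)`, and the unpaired term of the first row
  -- restores exactly these.
  S-suc : ∀ {d} → suc d < n → S (suc d) ≡ (H d +ℚ H (suc (suc d))) -ℚ (H (suc d) +ℚ H (suc d))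
  S-suc {d} d<n = begin
    S (suc d)
      ≡⟨ S-paired (suc d) ⟩
    ι (canAdd I 0 (suc d)) +ℚ ∑< n (λ i → ι (canAdd I (suc i) (suc i + suc d)) -ℚ ι (canRemove I i (i + suc d)))
      ≡⟨ cong₂ _+ℚ_ top (trans (∑<-cong n square) (∑<-linear n _ _ _ _)) ⟩
    (χ 0 d -ℚ χ 0 (suc d)) +ℚ (((H (suc (suc d)) +ℚ ∑< n (λ i → χ (suc i) (suc i + d)))
      -ℚ H (suc d)) -ℚ ∑< n (λ i → χ (suc i) (suc i + suc d)))
      ≡⟨ cong₂ (λ x y → (χ 0 d -ℚ χ 0 (suc d)) +ℚ (((H (suc (suc d)) +ℚ x) -ℚ H (suc d)) -ℚ y)) (H-shift d) (H-shift (suc d)) ⟩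
    (χ 0 d -ℚ χ 0 (suc d)) +ℚ (((H (suc (suc d)) +ℚ (H d -ℚ χ 0 d)) -ℚ H (suc d)) -ℚ (H (suc d) -ℚ χ 0 (suc d)))
      ≡⟨ solve 5 (λ x y h₀ h₁ h₂ → (x :- y) :+ (((h₂ :+ (h₀ :- x)) :- h₁) :- (h₁ :- y)) := (h₀ :+ h₂) :- (h₁ :+ h₁))
           refl (χ 0 d) (χ 0 (suc d)) (H d) (H (suc d)) (H (suc (suc d))) ⟩
    (H d +ℚ H (suc (suc d))) -ℚ (H (suc d) +ℚ H (suc d))
      ∎
    where
    open ≡-Reasoning
    top : ι (canAdd I 0 (suc d)) ≡ χ 0 d -ℚ χ 0 (suc d)
    top rewrite canAdd-top I d<n = ι-top (mem I 0 d) (mem I 0 (suc d)) (mem-↓ I {0} {d} {0} z≤n z≤n (ℕ.n≤1+n d))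
    square : ∀ i → ι (canAdd I (suc i) (suc i + suc d)) -ℚ ι (canRemove I i (i + suc d))
                 ≡ ((χ i (i + suc (suc d)) +ℚ χ (suc i) (suc i + d)) -ℚ χ i (i + suc d)) -ℚ χ (suc i) (suc i + suc d)
    -- With `j = i + d + 1` the columns of all four corners become `j` or `j + 1`, and `i < j` makes
    -- the square an interior one.
    square i rewrite ℕ.+-suc i (suc d) | ℕ.+-suc i d = square-interior (s≤s (ℕ.m≤m+n i d))

  -- The lost term is now `χ 0 0`, and the unpaired term at the origin is `1 - χ 0 0`. Their
  -- cancellation leaves the constant 1, the source of the ½ in each later step.
  S-zero : 0 < n → S 0 ≡ 1ℚ -ℚ ((H 0 -ℚ H 1) +ℚ (H 0 -ℚ H 1))
  S-zero 0<n = begin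
    S 0
      ≡⟨ S-paired 0 ⟩
    ι (canAdd I 0 0) +ℚ ∑< n (λ i → ι (canAdd I (suc i) (suc i + 0)) -ℚ ι (canRemove I i (i + 0)))
      ≡⟨ cong₂ _+ℚ_ (trans (cong ι (canAdd-origin I 0<n)) (ι-not (mem I 0 0)))
           (trans (∑<-cong n square) (∑<-linear n _ _ _ _)) ⟩
    (1ℚ -ℚ χ 0 0) +ℚ (((H 1 +ℚ H 1) -ℚ H 0) -ℚ ∑< n (λ i → χ (suc i) (suc i + 0)))
      ≡⟨ cong (λ x → (1ℚ -ℚ χ 0 0) +ℚ (((H 1 +ℚ H 1) -ℚ H 0) -ℚ x)) (H-shift 0) ⟩
    (1ℚ -ℚ χ 0 0) +ℚ (((H 1 +ℚ H 1) -ℚ H 0) -ℚ (H 0 -ℚ χ 0 0))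
      ≡⟨ solve 3 (λ x h₀ h₁ → (con 1ℚ :- x) :+ (((h₁ :+ h₁) :- h₀) :- (h₀ :- x)) := con 1ℚ :- ((h₀ :- h₁) :+ (h₀ :- h₁)))
           refl (χ 0 0) (H 0) (H 1) ⟩
    1ℚ -ℚ ((H 0 -ℚ H 1) +ℚ (H 0 -ℚ H 1))
      ∎
    where
    open ≡-Reasoning
    square : ∀ i → ι (canAdd I (suc i) (suc i + 0)) -ℚ ι (canRemove I i (i + 0))
                 ≡ ((χ i (i + 1) +ℚ χ i (i + 1)) -ℚ χ i (i + 0)) -ℚ χ (suc i) (suc i + 0)
    square i rewrite ℕ.+-suc i 0 | ℕ.+-identityʳ i = square-diagonal i

-- The span of the T x

TSpan : ∀ {n} → (𝒥 n → ℚ) → Set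
TSpan {n} f = Σ[ c ∈ (P n → ℚ) ] (∀ I → f I ≡ ∑ᴸ (elements n) (λ p → c p *ℚ t I p))

module _ {n : ℕ} where

  TSpan-cong : ∀ {f g : 𝒥 n → ℚ} → (∀ I → f I ≡ g I) → TSpan f → TSpan g
  TSpan-cong f≡g (c , f≡) = c , λ I → trans (sym (f≡g I)) (f≡ I)

  TSpan-0 : TSpan {n} (λ _ → 0ℚ)
  TSpan-0 = (λ _ → 0ℚ) , λ I → sym (trans
    (∑ᴸ-cong (elements n) (λ p → ℚ.*-zeroˡ (t I p))) (∑ᴸ-0 (elements n)))

  TSpan-+ : ∀ {f g : 𝒥 n → ℚ} → TSpan f → TSpan g → TSpan (λ I → f I +ℚ g I)
  TSpan-+ (c , f≡) (d , g≡) = (λ p → c p +ℚ d p) , λ I → trans (cong₂ _+ℚ_ (f≡ I) (g≡ I))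
    (sym (trans (∑ᴸ-cong (elements n) (λ p → ℚ.*-distribʳ-+ (t I p) (c p) (d p))) (∑ᴸ-+ (elements n) _ _)))

  TSpan-* : ∀ r {f : 𝒥 n → ℚ} → TSpan f → TSpan (λ I → r *ℚ f I)
  TSpan-* r (c , f≡) = (λ p → r *ℚ c p) , λ I → trans (cong (r *ℚ_) (f≡ I))
    (sym (trans (∑ᴸ-cong (elements n) (λ p → ℚ.*-assoc r (c p) (t I p))) (∑ᴸ-* (elements n) r _)))

  TSpan-S : ∀ d → TSpan {n} (λ I → S I d)
  TSpan-S d = (λ p → ι (does (onDiagonal? d p))) , λ I → ∑ᴸ-filter (onDiagonal? d) (elements n) (t I)

  -- Scaling `S 0` by -½ gives the case of diagonal 0. Since `S (d+1)` is the difference of the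
  -- consecutive differences `H d - H (d+1)` and `H (d+1) - H (d+2)`, subtracting it passes from one
  -- to the next and keeps the constant -½.
  TSpan-step : ∀ d → d < n → TSpan {n} (λ I → (H I d -ℚ H I (suc d)) -ℚ ½)
  TSpan-step zero    0<n = TSpan-cong
    (λ I → trans (cong ((-ℚ ½) *ℚ_) (S-zero I 0<n))
      (solve 2 (λ x y → (:- con ½) :* (con 1ℚ :- ((x :- y) :+ (x :- y))) := (x :- y) :- con ½) refl (H I 0) (H I 1)))
    (TSpan-* (-ℚ ½) (TSpan-S 0))
  TSpan-step (suc d) d<n = TSpan-cong
    (λ I → trans (cong (λ s → ((H I d -ℚ H I (suc d)) -ℚ ½) +ℚ ((-ℚ 1ℚ) *ℚ s)) (S-suc I d<n))
      (solve 3 (λ x y z → ((x :- y) :- con ½) :+ (:- con 1ℚ) :* ((x :+ z) :- (y :+ y)) := (y :- z) :- con ½)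
        refl (H I d) (H I (suc d)) (H I (suc (suc d)))))
    (TSpan-+ (TSpan-step d (ℕ.<⇒≤ d<n)) (TSpan-* (-ℚ 1ℚ) (TSpan-S (suc d))))

  H-out : ∀ I {d} → n ≤ d → H {n} I d ≡ 0ℚ
  H-out I {d} n≤d = ∑<-0 n (λ i → χ-out I i (ℕ.≤-trans n≤d (ℕ.m≤n+m d i)))

-- The quotient `(+ r) / 2` is reduced to lowest terms and does not compute for variable `r`, so the
-- equation is checked by cross multiplication on unnormalised fractions.
/2-suc : ∀ r → (+ suc r) / 2 ≡ ½ +ℚ (+ r) / 2
/2-suc r = ℚ.toℚᵘ-injective (begin
  ℚ.toℚᵘ ((+ suc r) / 2)              ≈⟨ ℚ.toℚᵘ-fromℚᵘ (ℚᵘ.mkℚᵘ (+ suc r) 1) ⟩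
  ℚᵘ.mkℚᵘ (+ suc r) 1                 ≈⟨ ℚᵘ.*≡* (crossMultiplied (+ r)) ⟩
  ℚ.toℚᵘ ½ ℚᵘ.+ ℚᵘ.mkℚᵘ (+ r) 1       ≈⟨ ℚᵘ.+-congʳ (ℚ.toℚᵘ ½) (ℚ.toℚᵘ-fromℚᵘ (ℚᵘ.mkℚᵘ (+ r) 1)) ⟨
  ℚ.toℚᵘ ½ ℚᵘ.+ ℚ.toℚᵘ ((+ r) / 2)    ≈⟨ ℚ.toℚᵘ-homo-+ ½ ((+ r) / 2) ⟨
  ℚ.toℚᵘ (½ +ℚ (+ r) / 2)             ∎)
  where
  open SetoidReasoning ℚᵘ.≃-setoid
  -- The factor `+ 4` is the denominator `2 * 2` of the unnormalised sum.
  crossMultiplied : ∀ x → (+ 1 ℤ.+ x) ℤ.* + 4 ≡ (+ 1 ℤ.* + 2 ℤ.+ x ℤ.* + 2) ℤ.* + 2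
  crossMultiplied = ℤS.solve 1 (λ x →
    (one ℤS.:+ x) ℤS.:* (two ℤS.:* two) ℤS.:= (one ℤS.:* two ℤS.:+ x ℤS.:* two) ℤS.:* two) refl
    where
    module ℤS = ℤ.+-*-Solver
    one two : ∀ {m} → ℤS.Polynomial m
    one = ℤS.con (+ 1)
    two = ℤS.con (+ 2)

-- Induction on the number `r` of diagonals from `k` to the end: each step adds one difference minus
-- ½, and the sum telescopes down from `H n = 0`.
TSpan-H : ∀ r k {n} → r + k ≡ n → TSpan {n} (λ I → H I k -ℚ (+ r) / 2)
TSpan-H zero    k refl = TSpan-cong (λ I → sym (cong (_-ℚ 0ℚ) (H-out I ℕ.≤-refl))) TSpan-0
TSpan-H (suc r) k refl = TSpan-cong
  (λ I → trans
    (solve 4 (λ x y h q → ((x :- y) :- h) :+ (y :- q) := x :- (h :+ q)) refl (H I k) (H I (suc k)) ½ ((+ r) / 2))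
    (cong (λ q → H I k -ℚ q) (sym (/2-suc r))))
  (TSpan-+ (TSpan-step k (s≤s (ℕ.m≤n+m k r))) (TSpan-H r (suc k) (ℕ.+-suc r k)))

-- From rational identities to Cauchy reals

seq-⟦⟧ : ∀ {A : Set} (a? : Dec A) m → seq ⟦ a? ⟧ m ≡ ι (does a?)
seq-⟦⟧ a? m with does a?
... | true  = refl
... | false = refl

seq-∑ : ∀ {A : Set} (xs : List A) f m → seq (∑ xs f) m ≡ ∑ᴸ xs (λ x → seq (f x) m)
seq-∑ []       f m = refl
seq-∑ (x ∷ xs) f m = cong (seq (f x) m +ℚ_) (seq-∑ xs f m)

seq≡⇒≈ : ∀ {x y : ℝ} → (∀ m → seq x m ≡ seq y m) → x ≈ y
seq≡⇒≈ {x} {y} eq ε 0<ε = 0 , λ m _ →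
  subst (ℚ._< ε) (sym (trans (cong (λ z → ℚ.∣ z -ℚ seq y m ∣) (eq m)) (cong ℚ.∣_∣ (ℚ.+-inverseʳ (seq y m))))) 0<ε

does-≟-true : ∀ b → does (b Bool.≟ true) ≡ b
does-≟-true true  = refl
does-≟-true false = refl

∑𝟙-diagonal : ∀ {n} k (I : 𝒥 n) m → seq (∑ (diagonal n k) (λ p → 𝟙 p I)) m ≡ H I k
∑𝟙-diagonal {n} k I m = begin
  seq (∑ (diagonal n k) (λ p → 𝟙 p I)) m           ≡⟨ seq-∑ (diagonal n k) _ m ⟩
  ∑ᴸ (diagonal n k) (λ p → seq (𝟙 p I) m)          ≡⟨ ∑ᴸ-cong (diagonal n k) (λ p → trans (seq-⟦⟧ (p ∈? I) m) (cong ι (does-≟-true (member I p)))) ⟩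
  ∑ᴸ (diagonal n k) (ι ∘ member I)                 ≡⟨ ∑-diagonal n k (ι ∘ member I) ⟩
  ∑< n (λ i → extend 0ℚ (ι ∘ member I) i (i + k))  ≡⟨ ∑<-cong n (λ i → extend-ι i (i + k)) ⟩
  H I k                                            ∎
  where
  open ≡-Reasoning
  extend-ι : ∀ i j → extend 0ℚ (ι ∘ member I) i j ≡ ι (mem I i j)
  extend-ι i j with at n i j
  ... | just _  = refl
  ... | nothing = refl

-- Real addition and multiplication act termwise on representing sequences, so with constant
-- sequences as coefficients the rational identity holds at every index, which is stronger than `≈`.
TSpan⇒≡ᵀ : ∀ {n} {f g : 𝒥 n → ℝ} {h : 𝒥 n → ℚ} →
           (∀ I m → seq (f I) m -ℚ seq (g I) m ≡ h I) → TSpan h → f ≡ᵀ g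
TSpan⇒≡ᵀ {n} {f} {g} f-g≡h (c , h≡) = (fromℚ ∘ c) , λ I →
  seq≡⇒≈ {f I -ᴿ g I} {∑ (elements n) (λ p → fromℚ (c p) *ᴿ T p I)} λ m → trans (f-g≡h I m) (trans (h≡ I) (sym (trans
    (seq-∑ (elements n) _ m)
    (∑ᴸ-cong (elements n) λ p → cong (c p *ℚ_) (cong₂ _-ℚ_
      (seq-⟦⟧ (minimalIn? (_∉? I) p) m) (seq-⟦⟧ (maximalIn? (_∈? I) p) m))))))

-- The target constant is written with integer subtraction, whereas the induction counts diagonals
-- by a natural number.
n-k≡n∸k : ∀ {n k} → k ≤ n → + n - + k ≡ + (n ∸ k)
n-k≡n∸k {n} {k} k≤n = trans (ℤ.m-n≡m⊖n n k) (ℤ.⊖-≥ k≤n)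

theorem3p17 : ∀ (n k : ℕ) → 1 ≤ n → k ≤ n ∸ 1 →
    (λ I → ∑ (diagonal n k) (λ p → 𝟙 p I)) ≡ᵀ (λ (I : 𝒥 n) → fromℚ ((+ n - + k) / 2))
theorem3p17 n k 1≤n k≤n-1 = TSpan⇒≡ᵀ
  {f = λ I → ∑ (diagonal n k) (λ p → 𝟙 p I)} {λ _ → fromℚ ((+ n - + k) / 2)}
  (λ I m → cong₂ _-ℚ_ (∑𝟙-diagonal k I m) (cong (_/ 2) (n-k≡n∸k k≤n)))
  (TSpan-H (n ∸ k) k (ℕ.m∸n+n≡m k≤n))
  where
  k≤n : k ≤ n
  k≤n = ℕ.≤-trans k≤n-1 (ℕ.m∸n≤m n 1)
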